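{- There is a constant $c > 0$ such that for every positive integer $n$ there exists a connected graph $G$ on $n$ vertices with $c_{\infty}(G) \ge c\, n$; that is, for each $n$ there is a connected $n$-vertex graph with cop number $\Theta(n)$.
   Context: Cops and Robber game with a fast robber: played on a finite simple graph $G$. The cops first choose initial vertices (several may share a vertex), then the robber chooses a vertex. Players alternate rounds, cops first. Each cop stays or moves to an adjacent vertex; the robber may stay or move along any path from her current vertex containing no vertex occupied by a cop. The cops win if a cop moves onto the robber's vertex; the robber wins if she evades forever. $c_{\infty}(G)$ (the cop number) is the minimum number of cops guaranteeing a cop win. -}

module Defs where

open import Level using (0ℓ)
open import Data.Nat using (ℕ; zero; suc)
open import Data.Fin using (Fin; toℕ)
open import Data.Vec using (Vec; tabulate)
open import Data.Product using (Σ; ∃; _×_)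
open import Data.Sum using (_⊎_)
open import Relation.Nullary using (¬_)
open import Relation.Binary.PropositionalEquality using (_≡_)

record Graph (n : ℕ) : Set₁ where
  field
    Adj   : Fin n → Fin n → Set
    sym   : ∀ {u v} → Adj u v → Adj v u
    irrefl : ∀ {u} → ¬ Adj u u
open Graph public

data Path {n : ℕ} (G : Graph n) : Fin n → Fin n → Set where
  here : ∀ {u} → Path G u u
  step : ∀ {u w v} → Adj G u w → Path G w v → Path G u v

Connected : ∀ {n} → Graph n → Set
Connected G = ∀ u v → Path G u v

Cops : ℕ → ℕ → Set
Cops n k = Fin k → Fin n

Occupied : ∀ {n k} → Cops n k → Fin n → Set
Occupied c v = ∃ λ i → c i ≡ v

-- Paths from u to v none of whose vertices (including u and v) is occupied
-- by a cop in position c: the legal fast-robber moves from u to v.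
data FreePath {n k : ℕ} (G : Graph n) (c : Cops n k) : Fin n → Fin n → Set where
  here : ∀ {u} → ¬ Occupied c u → FreePath G c u u
  step : ∀ {u w v} → ¬ Occupied c u → Adj G u w → FreePath G c w v → FreePath G c u v

-- A (deterministic, full-information) strategy for k cops: an initial placement,
-- and for each round t a rule that, given the robber's history r₀ … r_t and the
-- current cop positions, produces the new cop positions; every cop stays or
-- moves along an edge.
record CopStrategy {n : ℕ} (G : Graph n) (k : ℕ) : Set where
  field
    init  : Cops n k
    next  : (t : ℕ) → Vec (Fin n) (suc t) → Cops n k → Cops n k
    legal : ∀ t h c i → next t h c i ≡ c i ⊎ Adj G (c i) (next t h c i)
open CopStrategy public

history : ∀ {n} → (ℕ → Fin n) → (t : ℕ) → Vec (Fin n) (suc t)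
history r t = tabulate (λ i → r (toℕ i))

-- Cop positions at time t, against robber sequence r
-- (positions C_t are those after the cops' t-th move; C₀ = initial placement).
copPos : ∀ {n k} {G : Graph n} → CopStrategy G k → (ℕ → Fin n) → ℕ → Cops n k
copPos σ r zero    = init σ
copPos σ r (suc t) = next σ t (history r t) (copPos σ r t)

-- σ is winning: against every robber sequence r (r₀ chosen after seeing C₀,
-- r_{t+1} chosen after seeing C_{t+1}), the robber either starts on a cop, or at
-- some round t her position r_t is occupied after the cops' move (capture), or
-- she cannot legally move from r_t to r_{t+1} avoiding the cops at C_{t+1}.
-- (An illegal robber sequence is simply not a legal play; a legal sequence
-- fails FreePath exactly when the robber is captured.)
Winning : ∀ {n k} {G : Graph n} → CopStrategy G k → Set
Winning {n} {G = G} σ = ∀ (r : ℕ → Fin n) → Occupied (init σ) (r 0)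
  ⊎ ∃ λ t → ¬ FreePath G (copPos σ r (suc t)) (r t) (r (suc t))

CopWin : ∀ {n} → Graph n → ℕ → Set
CopWin G k = Σ (CopStrategy G k) Winning

{-# OPTIONS --safe #-}
module Submission where

-- Call a set large if it contains at least an eighth of the n vertices. There are
-- at most 4^n pairs of large sets, and a uniformly random edge joins a given pair
-- with probability at least 1/64, so 100 n greedily chosen edges join every such
-- pair. Drop the edges at the few vertices of high degree and add a path through
-- all vertices. If there are few cops, then only few vertices are within distance
-- one of a cop or have high degree, and the mixing property forces the remaining
-- vertices to have a component containing more than half of all vertices. The
-- robber stays in it: the components for two consecutive cop positions meet, and
-- both avoid the later position.

open import Defs
open import Level using (0ℓ)
open import Data.Bool using (Bool; true; false)
import Data.Bool.Properties as Bool
open import Data.Fin using (Fin; zero; suc; toℕ)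
import Data.Fin.Properties as Fin
open import Data.List using (List; []; _∷_; length; filter; cartesianProduct; map; _++_)
open import Data.List.Membership.Propositional using (_∈_)
open import Data.List.Membership.Propositional.Properties using (∈-filter⁺; ∈-cartesianProduct⁺; ∈-map⁺; ∈-++⁺ˡ; ∈-++⁺ʳ)
open import Data.List.Properties using (length-++; length-map; length-filter)
open import Data.List.Relation.Unary.All using (All; []; _∷_)
import Data.List.Relation.Unary.All as All
open import Data.List.Relation.Unary.All.Properties using (filter⁺; all-filter)
open import Data.List.Relation.Unary.Any using (here)
open import Data.Nat using (ℕ; zero; suc; _+_; _*_; _^_; _≤_; _<_; z≤n; s≤s; _≤?_; _<?_; NonZero)
open import Data.Nat.Properties
open import Data.Nat.Solver using (module +-*-Solver)
open import Data.Product using (Σ; ∃; _×_; _,_; proj₁; proj₂)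
open import Data.Sum using (_⊎_; inj₁; inj₂; [_,_]′)
open import Data.Vec using (Vec; []; _∷_; _∷ʳ_; lookup; tabulate)
open import Data.Vec.Properties using (lookup∘tabulate)
open import Function using (_∘_; id)
open import Relation.Binary using (IsEquivalence; tri<; tri≈; tri>)
open import Relation.Binary.Construct.Closure.ReflexiveTransitive using (Star; ε; _◅_; _◅◅_; reverse)
open import Relation.Binary.PropositionalEquality using (_≡_; _≢_; refl; cong; cong₂; subst; trans; module ≡-Reasoning)
import Relation.Binary.PropositionalEquality as ≡
open import Relation.Nullary using (¬_; Dec; yes; no; does; ¬?; contradiction; _×-dec_; _⊎-dec_)
open import Relation.Unary using (Pred; Decidable)
open import Data.Fin.Induction using (<-weakInduction)
open import Data.Product.Properties using (≡-dec)
import Data.Sum as Sum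
open import Relation.Nullary.Decidable using (toSum; dec-true)
open import Algebra.Properties.CommutativeSemigroup +-commutativeSemigroup using (interchange)
open import Algebra.Properties.Semiring.Sum +-*-semiring using (sum; ∑-distrib-+; ∑-comm; *-distribˡ-sum; sum-cong-≗)

private
  variable
    m n k : ℕ

-- Counting

sum-mono-≤ : {f g : Fin n → ℕ} → (∀ i → f i ≤ g i) → sum f ≤ sum g
sum-mono-≤ {zero}  f≤g = z≤n
sum-mono-≤ {suc n} f≤g = +-mono-≤ (f≤g zero) (sum-mono-≤ (f≤g ∘ suc))

sum≤n*c : ∀ {c} {f : Fin n → ℕ} → (∀ i → f i ≤ c) → sum f ≤ n * c
sum≤n*c {zero}  f≤c = z≤n
sum≤n*c {suc n} f≤c = +-mono-≤ (f≤c zero) (sum≤n*c (f≤c ∘ suc))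

term≤sum : (f : Fin n → ℕ) (i : Fin n) → f i ≤ sum f
term≤sum f zero    = m≤m+n _ _
term≤sum f (suc i) = ≤-trans (term≤sum (f ∘ suc) i) (m≤n+m _ _)

average : ∀ {c} (f : Fin (suc n) → ℕ) → suc n * c ≤ sum f → ∃ λ i → c ≤ f i
average {c = c} f le with Fin.any? (λ i → c ≤? f i)
... | yes p = p
... | no ¬p = contradiction le (<⇒≱ (+-mono-<-≤ (below zero) (sum≤n*c (<⇒≤ ∘ below ∘ suc))))
  where
  below : ∀ i → f i < c
  below i = ≰⇒> (λ q → ¬p (i , q))

ind : {P : Set} → Dec P → ℕ
ind (yes _) = 1
ind (no _)  = 0

ind≤ : ∀ {P : Set} {x} (P? : Dec P) → (P → 1 ≤ x) → ind P? ≤ x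
ind≤ (yes p) f = f p
ind≤ (no _)  f = z≤n

1≤ind : {P : Set} (P? : Dec P) → P → 1 ≤ ind P?
1≤ind (yes _) _ = ≤-refl
1≤ind (no ¬p) p = contradiction p ¬p

# : {P : Pred (Fin n) 0ℓ} → Decidable P → ℕ
# P? = sum (λ i → ind (P? i))

#≤sum : ∀ {P : Pred (Fin n) 0ℓ} (P? : Decidable P) (f : Fin n → ℕ) → (∀ {i} → P i → 1 ≤ f i) → # P? ≤ sum f
#≤sum P? f le = sum-mono-≤ (λ i → ind≤ (P? i) le)

#-mono : ∀ {P Q : Pred (Fin n) 0ℓ} (P? : Decidable P) (Q? : Decidable Q) → (∀ {i} → P i → Q i) → # P? ≤ # Q?
#-mono P? Q? sub = #≤sum P? _ (λ {i} → 1≤ind (Q? i) ∘ sub)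

#-∪ : ∀ {P Q R : Pred (Fin n) 0ℓ} (P? : Decidable P) (Q? : Decidable Q) (R? : Decidable R) →
  (∀ {i} → P i → Q i ⊎ R i) → # P? ≤ # Q? + # R?
#-∪ P? Q? R? sub = ≤-trans
  (#≤sum P? _ (λ {i} p → [ (λ q → ≤-trans (1≤ind (Q? i) q) (m≤m+n _ _)) , (λ r → ≤-trans (1≤ind (R? i) r) (m≤n+m _ _)) ]′ (sub p)))
  (≤-reflexive (∑-distrib-+ (λ i → ind (Q? i)) (λ i → ind (R? i))))

-- Union bound: after swapping the two sums, each point of `P` is counted at least once by the `R i`
-- that contains it.
#-⋃ : ∀ {P : Pred (Fin n) 0ℓ} {R : Fin m → Pred (Fin n) 0ℓ} (P? : Decidable P) (R? : ∀ i → Decidable (R i)) →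
  (∀ {v} → P v → ∃ λ i → R i v) → # P? ≤ sum (λ i → # (R? i))
#-⋃ P? R? sub = ≤-trans
  (#≤sum P? _ (λ {v} p → let i , r = sub p in ≤-trans (1≤ind (R? i v) r) (term≤sum (λ j → ind (R? j v)) i)))
  (≤-reflexive (∑-comm (λ v i → ind (R? i v))))

#-empty : ∀ {P : Pred (Fin n) 0ℓ} (P? : Decidable P) → (∀ {i} → ¬ P i) → # P? ≡ 0
#-empty {zero}  P? ¬p = refl
#-empty {suc n} P? ¬p with P? zero
... | yes p = contradiction p ¬p
... | no _  = #-empty (P? ∘ suc) ¬p

#-unique : ∀ {P : Pred (Fin n) 0ℓ} (P? : Decidable P) → (∀ {i j} → P i → P j → i ≡ j) → # P? ≤ 1
#-unique {zero}  P? uniq = z≤n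
#-unique {suc n} P? uniq with P? zero
... | yes p = ≤-reflexive (cong suc (#-empty (P? ∘ suc) (λ q → contradiction (uniq p q) λ ())))
... | no _  = #-unique (P? ∘ suc) (λ p q → Fin.suc-injective (uniq p q))

#-unique-ind : ∀ {P : Pred (Fin n) 0ℓ} {Q : Set} (P? : Decidable P) (Q? : Dec Q) →
  (∀ {i} → P i → Q) → (∀ {i j} → P i → P j → i ≡ j) → # P? ≤ ind Q?
#-unique-ind P? (yes _) imp uniq = #-unique P? uniq
#-unique-ind P? (no ¬q) imp uniq = ≤-reflexive (#-empty P? (¬q ∘ imp))

#-complement : ∀ {P Q : Pred (Fin n) 0ℓ} (P? : Decidable P) (Q? : Decidable Q) → (∀ i → P i ⊎ Q i) → n ≤ # P? + # Q?
#-complement {zero}  P? Q? cover = z≤n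
#-complement {suc n} P? Q? cover = begin
  suc n                                                        ≤⟨ +-mono-≤ head (#-complement (P? ∘ suc) (Q? ∘ suc) (cover ∘ suc)) ⟩
  (ind (P? zero) + ind (Q? zero)) + (# (P? ∘ suc) + # (Q? ∘ suc)) ≡⟨ interchange (ind (P? zero)) _ _ _ ⟩
  # P? + # Q?                                                  ∎
  where
  open ≤-Reasoning
  head : 1 ≤ ind (P? zero) + ind (Q? zero)
  head = [ (λ p → ≤-trans (1≤ind (P? zero) p) (m≤m+n _ _)) , (λ q → ≤-trans (1≤ind (Q? zero) q) (m≤n+m _ _)) ]′ (cover zero)

#-intersect : ∀ {P Q : Pred (Fin n) 0ℓ} (P? : Decidable P) (Q? : Decidable Q) → n < # P? + # Q? → ∃ λ i → P i × Q i
#-intersect {n} P? Q? lt with Fin.any? (λ i → P? i ×-dec Q? i)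
... | yes p = p
... | no ¬p = contradiction lt (≤⇒≯ (begin
  # P? + # Q?                              ≡⟨ ∑-distrib-+ (λ i → ind (P? i)) (λ i → ind (Q? i)) ⟨
  sum (λ i → ind (P? i) + ind (Q? i))      ≤⟨ sum≤n*c disjoint ⟩
  n * 1                                    ≡⟨ *-identityʳ n ⟩
  n                                        ∎))
  where
  open ≤-Reasoning
  disjoint : ∀ i → ind (P? i) + ind (Q? i) ≤ 1
  disjoint i with P? i | Q? i
  ... | yes p | yes q = contradiction (i , p , q) ¬p
  ... | yes _ | no _  = ≤-refl
  ... | no _  | yes _ = ≤-refl
  ... | no _  | no _  = z≤n

-- Markov's inequality: `f` dominates `c` times the indicator of `P` pointwise. It will bound the
-- number of vertices of high degree.
markov : ∀ {P : Pred (Fin n) 0ℓ} (P? : Decidable P) (f : Fin n → ℕ) (c : ℕ) → (∀ {i} → P i → c ≤ f i) → c * # P? ≤ sum f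
markov P? f c le = ≤-trans (≤-reflexive (*-distribˡ-sum c (λ i → ind (P? i)))) (sum-mono-≤ bound)
  where
  bound : ∀ i → c * ind (P? i) ≤ f i
  bound i with P? i
  ... | yes p = ≤-trans (≤-reflexive (*-identityʳ c)) (le p)
  ... | no _  = ≤-trans (≤-reflexive (*-zeroʳ c)) z≤n

-- Few edges meeting all pairs of large sets

module _ {X : Set} where

  length-filter-∷ : {P : Pred X 0ℓ} (P? : Decidable P) (x : X) (xs : List X) →
    length (filter P? (x ∷ xs)) ≡ ind (P? x) + length (filter P? xs)
  length-filter-∷ P? x xs with P? x
  ... | yes _ = refl
  ... | no _  = refl

  length-filter-filter : {P Q : Pred X 0ℓ} (P? : Decidable P) (Q? : Decidable Q) (xs : List X) →
    length (filter Q? (filter P? xs)) ≡ length (filter (λ x → P? x ×-dec Q? x) xs)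
  length-filter-filter P? Q? [] = refl
  length-filter-filter P? Q? (x ∷ xs) with P? x
  ... | no _ = length-filter-filter P? Q? xs
  ... | yes _ with Q? x
  ...   | yes _ = cong suc (length-filter-filter P? Q? xs)
  ...   | no _  = length-filter-filter P? Q? xs

  length-filter-split : {P : Pred X 0ℓ} (P? : Decidable P) (xs : List X) →
    length xs ≡ length (filter P? xs) + length (filter (¬? ∘ P?) xs)
  length-filter-split P? [] = refl
  length-filter-split P? (x ∷ xs) with P? x
  ... | yes _ = cong suc (length-filter-split P? xs)
  ... | no _  = trans (cong suc (length-filter-split P? xs)) (≡.sym (+-suc _ _))

  module _ {Mem : X → Pred (Fin n) 0ℓ} (mem? : ∀ x → Decidable (Mem x)) (d : ℕ) where

    -- Counts incidences between points and list entries: summed over entries, each contributes at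
    -- least `n / d`; summed over points, they give the right-hand side.
    doubleCount : (xs : List X) → All (λ x → n ≤ d * # (mem? x)) xs →
      n * length xs ≤ d * sum (λ v → length (filter (λ x → mem? x v) xs))
    doubleCount [] [] = ≤-trans (≤-reflexive (*-zeroʳ n)) z≤n
    doubleCount (x ∷ xs) (big ∷ bigs) = begin
      n * suc (length xs)            ≡⟨ *-suc n _ ⟩
      n + n * length xs              ≤⟨ +-mono-≤ big (doubleCount xs bigs) ⟩
      d * # (mem? x) + d * sum rest  ≡⟨ *-distribˡ-+ d _ _ ⟨
      d * (# (mem? x) + sum rest)    ≡⟨ cong (d *_) (∑-distrib-+ (λ v → ind (mem? x v)) rest) ⟨
      d * sum (λ v → ind (mem? x v) + rest v)
        ≡⟨ cong (d *_) (sum-cong-≗ (λ v → length-filter-∷ (λ y → mem? y v) x xs)) ⟨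
      d * sum (λ v → length (filter (λ y → mem? y v) (x ∷ xs))) ∎
      where
      open ≤-Reasoning
      rest : Fin n → ℕ
      rest v = length (filter (λ y → mem? y v) xs)

  popularPoint : {Mem : X → Pred (Fin (suc n)) 0ℓ} (mem? : ∀ x → Decidable (Mem x)) (d : ℕ) (xs : List X) →
    All (λ x → suc n ≤ d * # (mem? x)) xs → ∃ λ v → length xs ≤ d * length (filter (λ x → mem? x v) xs)
  popularPoint mem? d xs bigs = average _ (≤-trans (doubleCount mem? d xs bigs)
    (≤-reflexive (*-distribˡ-sum d (λ v → length (filter (λ x → mem? x v) xs)))))

length-cartesianProduct : {X Y : Set} (xs : List X) (ys : List Y) → length (cartesianProduct xs ys) ≡ length xs * length ys
length-cartesianProduct []       ys = refl
length-cartesianProduct (x ∷ xs) ys = trans (length-++ (map (x ,_) ys))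
  (cong₂ _+_ (length-map (x ,_) ys) (length-cartesianProduct xs ys))

_∋_ : Vec Bool n → Pred (Fin n) 0ℓ
S ∋ v = lookup S v ≡ true

_∋?_ : (S : Vec Bool n) → Decidable (S ∋_)
S ∋? v = lookup S v Bool.≟ true

subsets : ∀ n → List (Vec Bool n)
subsets zero    = [] ∷ []
subsets (suc n) = map (true ∷_) (subsets n) ++ map (false ∷_) (subsets n)

length-subsets : ∀ n → length (subsets n) ≡ 2 ^ n
length-subsets zero    = refl
length-subsets (suc n) = begin
  length (subsets (suc n))                 ≡⟨ length-++ (map (true ∷_) (subsets n)) ⟩
  length (map (true ∷_) (subsets n)) + length (map (false ∷_) (subsets n))
    ≡⟨ cong₂ _+_ (half true) (trans (half false) (≡.sym (+-identityʳ _))) ⟩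
  2 ^ n + (2 ^ n + 0)                      ∎
  where
  open ≡-Reasoning
  half : ∀ b → length (map (b ∷_) (subsets n)) ≡ 2 ^ n
  half b = trans (length-map (b ∷_) (subsets n)) (length-subsets n)

∈-subsets : (S : Vec Bool n) → S ∈ subsets n
∈-subsets []          = here refl
∈-subsets (true ∷ S)  = ∈-++⁺ˡ (∈-map⁺ (true ∷_) (∈-subsets S))
∈-subsets (false ∷ S) = ∈-++⁺ʳ (map (true ∷_) (subsets _)) (∈-map⁺ (false ∷_) (∈-subsets S))

Large : {P : Pred (Fin n) 0ℓ} → Decidable P → Set
Large {n} P? = n ≤ 8 * # P?

SetPair : ℕ → Set
SetPair n = Vec Bool n × Vec Bool n

LargePair : SetPair n → Set
LargePair (S , T) = Large (S ∋?_) × Large (T ∋?_)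

Hits : Fin n × Fin n → SetPair n → Set
Hits (u , v) (S , T) = S ∋ u × T ∋ v

hits? : (e : Fin n × Fin n) → Decidable (Hits e)
hits? (u , v) (S , T) = (S ∋? u) ×-dec (T ∋? v)

-- Some `u` lies in an eighth of the first sets, and among the surviving pairs some `v` lies in an
-- eighth of the second sets, so `(u , v)` hits a 1/64 share.
popularEdge : (L : List (SetPair (suc n))) → All LargePair L →
  ∃ λ e → 64 * length (filter (¬? ∘ hits? e) L) ≤ 63 * length L
-- Adding `length L` to both sides turns the lower bound on `hit` into an upper bound on `missed`
-- without subtraction.
popularEdge {n} L large = (u , v) , +-cancelˡ-≤ (length L) _ _ (begin
  length L + 64 * missed     ≤⟨ +-monoˡ-≤ (64 * missed) many ⟩
  64 * hit + 64 * missed     ≡⟨ *-distribˡ-+ 64 hit missed ⟨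
  64 * (hit + missed)        ≡⟨ cong (64 *_) (length-filter-split (hits? (u , v)) L) ⟨
  64 * length L              ∎)
  where
  open ≤-Reasoning
  first : ∃ λ u → length L ≤ 8 * length (filter (λ x → proj₁ x ∋? u) L)
  first = popularPoint (λ x → proj₁ x ∋?_) 8 L (All.map proj₁ large)
  u = proj₁ first
  L₁ = filter (λ x → proj₁ x ∋? u) L
  second : ∃ λ v → length L₁ ≤ 8 * length (filter (λ x → proj₂ x ∋? v) L₁)
  second = popularPoint (λ x → proj₂ x ∋?_) 8 L₁ (filter⁺ (λ x → proj₁ x ∋? u) (All.map proj₂ large))
  v = proj₁ second
  hit missed : ℕ
  hit    = length (filter (hits? (u , v)) L)
  missed = length (filter (¬? ∘ hits? (u , v)) L)
  many : length L ≤ 64 * hit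
  many = begin
    length L        ≤⟨ proj₂ first ⟩
    8 * length L₁   ≤⟨ *-monoʳ-≤ 8 (proj₂ second) ⟩
    8 * (8 * length (filter (λ x → proj₂ x ∋? v) L₁))
      ≡⟨ cong (λ z → 8 * (8 * z)) (length-filter-filter (λ x → proj₁ x ∋? u) (λ x → proj₂ x ∋? v) L) ⟩
    8 * (8 * hit)   ≡⟨ *-assoc 8 8 hit ⟨
    64 * hit        ∎

EdgeList : ℕ → ℕ → Set
EdgeList m n = Fin m → Fin n × Fin n

_◂_ : Fin n × Fin n → EdgeList m n → EdgeList (suc m) n
(e ◂ E) zero    = e
(e ◂ E) (suc i) = E i

-- The greedy invariant: when the list shrinks by the factor `a / b`, the budget for one edge fewer
-- still holds.
geometric-step : ∀ a b m {x y} → b * y ≤ a * x → a ^ suc m * x < b ^ suc m → a ^ m * y < b ^ m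
geometric-step a b m {x} {y} shrink small = *-cancelˡ-< b _ _ (begin-strict
  b * (a ^ m * y)   ≡⟨ x∙yz≈y∙xz b (a ^ m) y ⟩
  a ^ m * (b * y)   ≤⟨ *-monoʳ-≤ (a ^ m) shrink ⟩
  a ^ m * (a * x)   ≡⟨ x∙yz≈yx∙z (a ^ m) a x ⟩
  a ^ suc m * x     <⟨ small ⟩
  b ^ suc m         ∎)
  where
  open ≤-Reasoning
  open import Algebra.Properties.CommutativeSemigroup *-commutativeSemigroup using (x∙yz≈y∙xz; x∙yz≈yx∙z)

hits-◂ : (e : Fin n × Fin n) (E : EdgeList m n) (L : List (SetPair n)) →
  (∀ {x} → x ∈ filter (¬? ∘ hits? e) L → ∃ λ i → Hits (E i) x) →
  ∀ {x} → x ∈ L → ∃ λ i → Hits ((e ◂ E) i) x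
hits-◂ e E L hit {x} x∈L with hits? e x
... | yes h = zero , h
... | no ¬h = let i , h = hit (∈-filter⁺ (¬? ∘ hits? e) x∈L ¬h) in suc i , h

-- Each edge is chosen to hit at least 1/64 of the pairs not hit so far.
greedyEdges : ∀ m (L : List (SetPair (suc n))) → All LargePair L → 63 ^ m * length L < 64 ^ m →
  Σ (EdgeList m (suc n)) λ E → ∀ {x} → x ∈ L → ∃ λ i → Hits (E i) x
greedyEdges zero [] _ _ = (λ ()) , λ ()
-- With no edges left to choose, the budget says that the list has length below 1.
greedyEdges zero (x ∷ L) _ (s≤s ())
greedyEdges (suc m) L large few =
  let e , shrink = popularEdge L large
      E , hit    = greedyEdges m (filter (¬? ∘ hits? e) L) (filter⁺ (¬? ∘ hits? e) large) (geometric-step 63 64 m shrink few)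
  in e ◂ E , hits-◂ e E L hit

-- Quantifying over decidable predicates lets unions of component classes be plugged in directly;
-- they pass to Boolean vectors, of which there are finitely many, through `toSet`.
Mixing : EdgeList m n → Set₁
Mixing {m} {n} E = ∀ {P Q : Pred (Fin n) 0ℓ} (P? : Decidable P) (Q? : Decidable Q) → Large P? → Large Q? →
  ∃ λ i → P (proj₁ (E i)) × Q (proj₂ (E i))

toSet : {P : Pred (Fin n) 0ℓ} → Decidable P → Vec Bool n
toSet P? = tabulate (does ∘ P?)

∋-toSet⁺ : {P : Pred (Fin n) 0ℓ} (P? : Decidable P) {v : Fin n} → P v → toSet P? ∋ v
∋-toSet⁺ P? {v} p = trans (lookup∘tabulate (does ∘ P?) v) (dec-true (P? v) p)

∋-toSet⁻ : {P : Pred (Fin n) 0ℓ} (P? : Decidable P) {v : Fin n} → toSet P? ∋ v → P v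
∋-toSet⁻ P? {v} mem with P? v | trans (≡.sym (lookup∘tabulate (does ∘ P?) v)) mem
... | yes p | _ = p

^-distribʳ-* : ∀ n a b → (a * b) ^ n ≡ a ^ n * b ^ n
^-distribʳ-* zero    a b = refl
^-distribʳ-* (suc n) a b = trans (cong (a * b *_) (^-distribʳ-* n a b)) ([m*n]*[o*p]≡[m*o]*[n*p] a b (a ^ n) (b ^ n))

-- The `n`-th power of the hypothesis: if `c` edges per vertex gain a factor above 4, then `c * n`
-- edges outweigh all pairs of subsets.
^-beats-4^ : ∀ a b c n .{{_ : NonZero n}} → a ^ c * 4 < b ^ c → a ^ (c * n) * (2 ^ n * 2 ^ n) < b ^ (c * n)
^-beats-4^ a b c n lt = begin-strict
  a ^ (c * n) * (2 ^ n * 2 ^ n)   ≡⟨ cong₂ _*_ (^-*-assoc a c n) (^-distribʳ-* n 2 2) ⟨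
  (a ^ c) ^ n * 4 ^ n             ≡⟨ ^-distribʳ-* n (a ^ c) 4 ⟨
  (a ^ c * 4) ^ n                 <⟨ ^-monoˡ-< n lt ⟩
  (b ^ c) ^ n                     ≡⟨ ^-*-assoc b c n ⟩
  b ^ (c * n)                     ∎
  where open ≤-Reasoning

-- Here (64/63)^100 is about 4.8. The inequality is decided by evaluating both sides.
63^100*4<64^100 : 63 ^ 100 * 4 < 64 ^ 100
63^100*4<64^100 = <ᵇ⇒< (63 ^ 100 * 4) (64 ^ 100) _

sparseMixing : ∀ n → Σ (EdgeList (100 * suc n) (suc n)) Mixing
sparseMixing n = proj₁ greedy , λ P? Q? largeP largeQ →
  let i , hp , hq = proj₂ greedy (∈-filter⁺ largePair? (∈-cartesianProduct⁺ (∈-subsets (toSet P?)) (∈-subsets (toSet Q?)))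
                      (≤-trans largeP (*-monoʳ-≤ 8 (#-mono P? (toSet P? ∋?_) (∋-toSet⁺ P?))) ,
                       ≤-trans largeQ (*-monoʳ-≤ 8 (#-mono Q? (toSet Q? ∋?_) (∋-toSet⁺ Q?)))))
  in i , ∋-toSet⁻ P? hp , ∋-toSet⁻ Q? hq
  where
  open ≤-Reasoning
  N = suc n
  largePair? : Decidable (LargePair {N})
  largePair? (S , T) = (N ≤? 8 * # (S ∋?_)) ×-dec (N ≤? 8 * # (T ∋?_))
  pairs : List (SetPair N)
  pairs = cartesianProduct (subsets N) (subsets N)
  few : length (filter largePair? pairs) ≤ 2 ^ N * 2 ^ N
  few = begin
    length (filter largePair? pairs)         ≤⟨ length-filter largePair? pairs ⟩
    length pairs                             ≡⟨ length-cartesianProduct (subsets N) (subsets N) ⟩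
    length (subsets N) * length (subsets N)  ≡⟨ cong₂ _*_ (length-subsets N) (length-subsets N) ⟩
    2 ^ N * 2 ^ N                            ∎
  greedy = greedyEdges (100 * N) (filter largePair? pairs) (all-filter largePair? pairs)
    (≤-<-trans (*-monoʳ-≤ (63 ^ (100 * N)) few) (^-beats-4^ 63 64 100 N 63^100*4<64^100))

-- Components and evasion

-- A union step on labels: class `a` is renamed to `b`.
merge : Fin n → Fin n → Fin n → Fin n
merge a b x with x Fin.≟ a
... | yes _ = b
... | no _  = x

merge-joins : (a b : Fin n) → merge a b a ≡ merge a b b
merge-joins a b with a Fin.≟ a | b Fin.≟ a
... | yes _ | yes _ = refl
... | yes _ | no _  = refl
... | no a≢a | _    = contradiction refl a≢a

merge-reflects : (a b : Fin n) {x y : Fin n} → merge a b x ≡ merge a b y →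
  x ≡ y ⊎ (x ≡ a × y ≡ b) ⊎ (x ≡ b × y ≡ a)
merge-reflects a b {x} {y} eq with x Fin.≟ a | y Fin.≟ a
... | yes x≡a | yes y≡a = inj₁ (trans x≡a (≡.sym y≡a))
... | yes x≡a | no _    = inj₂ (inj₁ (x≡a , ≡.sym eq))
... | no _    | yes y≡a = inj₂ (inj₂ (eq , y≡a))
... | no _    | no _    = inj₁ eq

-- Adds the kept edges one at a time, merging the labels of their ends. The classes may be finer
-- than those of `~`: endpoints of kept edges share a label, and equal labels imply `~`.
components : {_~_ : Fin n → Fin n → Set} → IsEquivalence _~_ → (E : EdgeList m n) {Kept : Pred (Fin m) 0ℓ} → Decidable Kept →
  (∀ {i} → Kept i → proj₁ (E i) ~ proj₂ (E i)) →
  Σ (Fin n → Fin n) λ label → (∀ {i} → Kept i → label (proj₁ (E i)) ≡ label (proj₂ (E i))) × (∀ {u v} → label u ≡ label v → u ~ v)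
components {m = zero} equiv E kept? sound = id , (λ { {()} }) , λ { refl → IsEquivalence.refl equiv }
components {m = suc m} {_~_ = _~_} equiv E {Kept} kept? sound
  with kept? zero | components equiv (E ∘ suc) (kept? ∘ suc) sound
... | no ¬k | label , respects , reflects = label , (λ { {zero} k → contradiction k ¬k ; {suc i} k → respects k }) , reflects
... | yes k | label , respects , reflects = merge a b ∘ label , respects′ , reflects′
  where
  module ~ = IsEquivalence equiv
  a b : Fin _
  a = label (proj₁ (E zero))
  b = label (proj₂ (E zero))
  respects′ : ∀ {i} → Kept i → merge a b (label (proj₁ (E i))) ≡ merge a b (label (proj₂ (E i)))
  respects′ {zero}  _ = merge-joins a b
  respects′ {suc i} k = cong (merge a b) (respects k)
  reflects′ : ∀ {u v} → merge a b (label u) ≡ merge a b (label v) → u ~ v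
  reflects′ eq with merge-reflects a b eq
  ... | inj₁ same              = reflects same
  ... | inj₂ (inj₁ (u~a , v~b)) = ~.trans (reflects u~a) (~.trans (sound k) (~.sym (reflects v~b)))
  ... | inj₂ (inj₂ (u~b , v~a)) = ~.trans (reflects u~b) (~.trans (~.sym (sound k)) (~.sym (reflects v~a)))

-- Refuges and the robber's strategy

Near : Graph n → Fin n → Fin n → Set
Near G u v = u ≡ v ⊎ Adj G u v

-- Distance at least two from every cop, so such a vertex is still unoccupied after the cops' next
-- move.
Away : Graph n → Cops n k → Pred (Fin n) 0ℓ
Away G c v = ∀ i → ¬ Near G (c i) v

AwayStep : Graph n → Cops n k → Fin n → Fin n → Set
AwayStep G c u v = Adj G u v × Away G c u × Away G c v

-- `majority` makes any two refuges meet. The walks in `linked` may leave `Region`, but all their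
-- vertices are away from the cops.
record Refuge (G : Graph n) (c : Cops n k) : Set₁ where
  field
    Region   : Pred (Fin n) 0ℓ
    region?  : Decidable Region
    majority : n < # region? + # region?
    away     : ∀ {v} → Region v → Away G c v
    linked   : ∀ {u v} → Region u → Region v → Star (AwayStep G c) u v

_++ᶠ_ : ∀ {G : Graph n} {c : Cops n k} {u v w} → FreePath G c u v → FreePath G c v w → FreePath G c u w
here _          ++ᶠ q = q
step free adj p ++ᶠ q = step free adj (p ++ᶠ q)

-- Used twice per round: with `c′` the position after the cops' move, and with `c′` equal to `c`.
freePath : ∀ {G : Graph n} {c c′ : Cops n k} → (∀ {v} → Away G c v → ¬ Occupied c′ v) →
  ∀ {u v} → Away G c u → Star (AwayStep G c) u v → FreePath G c′ u v
freePath free a ε                      = here (free a)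
freePath free a ((adj , _ , a′) ◅ s) = step (free a) adj (freePath free a′ s)

history-∷ʳ : (r : ℕ → Fin n) (t : ℕ) → history r (suc t) ≡ history r t ∷ʳ r (suc t)
history-∷ʳ r t = tabulate-∷ʳ r (suc t)
  where
  tabulate-∷ʳ : (r : ℕ → Fin _) (t : ℕ) → tabulate {n = suc t} (r ∘ toℕ) ≡ tabulate {n = t} (r ∘ toℕ) ∷ʳ r t
  tabulate-∷ʳ r zero    = refl
  tabulate-∷ʳ r (suc t) = cong (r 0 ∷_) (tabulate-∷ʳ (r ∘ suc) t)

module _ {G : Graph n} (σ : CopStrategy G k) (respond : Cops n k → Fin n) where

  -- The cops react to the robber's sequence and the robber to the cops. Building history and
  -- positions together resolves this circularity; `history-play` and `copPos-play` then identify
  -- them with the official ones.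
  play : (t : ℕ) → Vec (Fin n) (suc t) × Cops n k
  play zero    = respond (init σ) ∷ [] , init σ
  play (suc t) = let h , c = play t ; c′ = next σ t h c in h ∷ʳ respond c′ , c′

  robber : ℕ → Fin n
  robber t = respond (proj₂ (play t))

  history-play : ∀ t → history robber t ≡ proj₁ (play t)
  history-play zero    = refl
  history-play (suc t) = trans (history-∷ʳ robber t) (cong (_∷ʳ robber (suc t)) (history-play t))

  copPos-play : ∀ t → copPos σ robber t ≡ proj₂ (play t)
  copPos-play zero    = refl
  copPos-play (suc t) = cong₂ (next σ t) (history-play t) (copPos-play t)

  robber-responds : ∀ t → robber t ≡ respond (copPos σ robber t)
  robber-responds t = cong respond (≡.sym (copPos-play t))

evasion : {G : Graph n} → ((c : Cops n k) → Refuge G c) → ¬ CopWin G k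
evasion {n} {k} {G} refuge (σ , wins) = [ notCaught , (λ (t , ¬free) → ¬free (move t)) ]′ (wins r)
  where
  open Refuge
  -- A majority region meets itself, which yields a vertex of it.
  inhabited : ∀ c → ∃ λ v → Region (refuge c) v × Region (refuge c) v
  inhabited c = #-intersect (region? (refuge c)) (region? (refuge c)) (majority (refuge c))
  r : ℕ → Fin n
  r = robber σ (proj₁ ∘ inhabited)
  C : ℕ → Cops n k
  C = copPos σ r
  inRegion : ∀ t → Region (refuge (C t)) (r t)
  inRegion t = subst (Region (refuge (C t))) (≡.sym (robber-responds σ (proj₁ ∘ inhabited) t)) (proj₁ (proj₂ (inhabited (C t))))
  notCaught : ¬ Occupied (init σ) (r 0)
  notCaught (i , eq) = away (refuge (C 0)) (inRegion 0) i (inj₁ eq)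
  move : ∀ t → FreePath G (C (suc t)) (r t) (r (suc t))
  move t =
    let now   = refuge (C t)
        later = refuge (C (suc t))
        w , w∈now , w∈later = #-intersect (region? now) (region? later) (meeting (# (region? now)) (# (region? later)) (majority now) (majority later))
    -- The robber runs to the common vertex `w` inside the old refuge, then on inside the new one.
    in freePath escaped (away now (inRegion t)) (linked now (inRegion t) w∈now)
       ++ᶠ freePath (λ a (i , eq) → a i (inj₁ eq)) (away later w∈later) (linked later w∈later (inRegion (suc t)))
    where
    meeting : ∀ a b → n < a + a → n < b + b → n < a + b
    meeting a b n<2a n<2b with ≤-total a b
    ... | inj₁ a≤b = <-≤-trans n<2a (+-monoʳ-≤ a a≤b)
    ... | inj₂ b≤a = <-≤-trans n<2b (+-monoˡ-≤ b b≤a)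
    escaped : ∀ {v} → Away G (C t) v → ¬ Occupied (C (suc t)) v
    -- By legality, a cop now on `v` was on `v` or adjacent to it before the move.
    escaped a (i , refl) = a i ([ inj₁ ∘ ≡.sym , inj₂ ]′ (legal σ t (history r t) (C t) i))

-- A connected mixing graph of bounded degree

Consecutive : Fin n → Fin n → Set
Consecutive u v = toℕ v ≡ suc (toℕ u)

module SparseGraph {m n : ℕ} (E : EdgeList m n) (K : ℕ) where

  -- Counts edge ends with multiplicity, so repeated edges and loops count fully; this only
  -- overestimates the number of linked neighbours.
  degree : Fin n → ℕ
  degree u = sum (λ e → ind (proj₁ (E e) Fin.≟ u) + ind (proj₂ (E e) Fin.≟ u))

  Low : Pred (Fin n) 0ℓ
  Low u = degree u ≤ K

  low? : Decidable Low
  low? u = degree u ≤? K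

  Joins : Fin n → Fin n → Fin m → Set
  Joins u v e = E e ≡ (u , v) ⊎ E e ≡ (v , u)

  joins? : ∀ u v → Decidable (Joins u v)
  joins? u v e = ≡-dec Fin._≟_ Fin._≟_ (E e) (u , v) ⊎-dec ≡-dec Fin._≟_ Fin._≟_ (E e) (v , u)

  -- The greedy edges may include loops, hence `u ≢ v`; `Low` is required at both ends to keep the
  -- relation symmetric.
  Link : Fin n → Fin n → Set
  Link u v = Low u × Low v × u ≢ v × ∃ (Joins u v)

  link? : ∀ u → Decidable (Link u)
  link? u v = low? u ×-dec (low? v ×-dec (¬? (u Fin.≟ v) ×-dec Fin.any? (joins? u v)))

  -- The path through all vertices makes the graph connected; edges of E at
  -- vertices of high degree are dropped, which bounds the degrees.
  G : Graph n
  G = record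
    { Adj    = λ u v → (Consecutive u v ⊎ Consecutive v u) ⊎ Link u v
    ; sym    = Sum.map Sum.swap (λ (lu , lv , u≢v , e , j) → lv , lu , u≢v ∘ ≡.sym , e , Sum.swap j)
    ; irrefl = [ [ n≢1+n , n≢1+n ]′ , (λ (_ , _ , u≢u , _) → u≢u refl) ]′
    }
    where
    n≢1+n : ∀ {x} → x ≢ suc x
    n≢1+n ()

  next? : (u : Fin n) → Decidable (Consecutive u)
  next? u v = toℕ v ≟ suc (toℕ u)

  previous? : (u : Fin n) → Decidable (λ v → Consecutive v u)
  previous? u v = toℕ u ≟ suc (toℕ v)

  near? : ∀ u → Decidable (Near G u)
  near? u v = (u Fin.≟ v) ⊎-dec ((next? u v ⊎-dec previous? u v) ⊎-dec link? u v)

  -- A listed edge supplies at most as many neighbours of `u` as it has ends at `u`; a high vertex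
  -- has no links at all.
  #-link : ∀ u → # (link? u) ≤ K
  #-link u = [ lowCase , (λ high → ≤-trans (≤-reflexive (#-empty (link? u) (high ∘ proj₁))) z≤n) ]′ (toSum (low? u))
    where
    ends : ∀ e → # (λ v → joins? u v e) ≤ ind (proj₁ (E e) Fin.≟ u) + ind (proj₂ (E e) Fin.≟ u)
    ends e = ≤-trans (#-∪ (λ v → joins? u v e) out? in? id) (+-mono-≤
      (#-unique-ind out? (proj₁ (E e) Fin.≟ u) (cong proj₁) (λ p q → cong proj₂ (trans (≡.sym p) q)))
      (#-unique-ind in? (proj₂ (E e) Fin.≟ u) (cong proj₂) (λ p q → cong proj₁ (trans (≡.sym p) q))))
      where
      out? : Decidable (λ v → E e ≡ (u , v))
      out? v = ≡-dec Fin._≟_ Fin._≟_ (E e) (u , v)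
      in? : Decidable (λ v → E e ≡ (v , u))
      in? v = ≡-dec Fin._≟_ Fin._≟_ (E e) (v , u)
    lowCase : Low u → # (link? u) ≤ K
    lowCase low = ≤-trans (#-⋃ (link? u) (λ e v → joins? u v e) (proj₂ ∘ proj₂ ∘ proj₂)) (≤-trans (sum-mono-≤ ends) low)

  -- The 3 accounts for `u` itself and its two neighbours on the path.
  #-near : ∀ u → # (near? u) ≤ 3 + K
  #-near u = ≤-trans (#-∪ (near? u) (u Fin.≟_) adj? id) (+-mono-≤ (#-unique (u Fin.≟_) (λ p q → trans (≡.sym p) q))
    (≤-trans (#-∪ adj? path? (link? u) id) (+-mono-≤ (≤-trans (#-∪ path? (next? u) (previous? u) id) (+-mono-≤
      (#-unique (next? u) (λ p q → Fin.toℕ-injective (trans p (≡.sym q))))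
      (#-unique (previous? u) (λ p q → Fin.toℕ-injective (suc-injective (trans (≡.sym p) q)))))) (#-link u))))
    where
    path? : Decidable (λ v → Consecutive u v ⊎ Consecutive v u)
    path? v = next? u v ⊎-dec previous? u v
    adj? : Decidable (Adj G u)
    adj? v = path? v ⊎-dec link? u v

  high? : Decidable (λ u → ¬ Low u)
  high? u = ¬? (low? u)

  sum-degree : sum degree ≤ m * 2
  sum-degree = begin
    sum degree  ≡⟨ ∑-comm (λ u e → ind (proj₁ (E e) Fin.≟ u) + ind (proj₂ (E e) Fin.≟ u)) ⟩
    sum (λ e → sum (λ u → ind (proj₁ (E e) Fin.≟ u) + ind (proj₂ (E e) Fin.≟ u)))
      ≤⟨ sum≤n*c (λ e → ≤-trans (≤-reflexive (∑-distrib-+ (λ u → ind (proj₁ (E e) Fin.≟ u)) _)) (+-mono-≤ (single (proj₁ (E e))) (single (proj₂ (E e))))) ⟩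
    m * 2       ∎
    where
    open ≤-Reasoning
    single : ∀ w → # (w Fin.≟_) ≤ 1
    single w = #-unique (w Fin.≟_) (λ p q → trans (≡.sym p) q)

  #-high : K * # high? ≤ m * 2
  #-high = ≤-trans (markov high? degree K (≰⇒≥)) sum-degree

-- The path edges suffice: every vertex is reached from `zero` by induction, and two vertices are
-- joined through `zero`.
connected : (E : EdgeList m (suc n)) (K : ℕ) → Connected (SparseGraph.G E K)
connected {n = n} E K u v = toPath (reverse (Graph.sym G) (fromZero u) ◅◅ fromZero v)
  where
  open SparseGraph E K
  fromZero : ∀ v → Star (Adj G) zero v
  fromZero = <-weakInduction (Star (Adj G) zero) ε (λ i s → s ◅◅ (inj₁ (inj₁ (cong suc (≡.sym (Fin.toℕ-inject₁ i)))) ◅ ε))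
  toPath : ∀ {u v} → Star (Adj G) u v → Path G u v
  toPath ε         = here
  toPath (adj ◅ s) = step adj (toPath s)

-- A majority class among the safe vertices

compare : ∀ a b → a < b ⊎ a ≡ b ⊎ b < a
compare a b with <-cmp a b
... | tri< lt _ _ = inj₁ lt
... | tri≈ _ eq _ = inj₂ (inj₁ eq)
... | tri> _ _ gt = inj₂ (inj₂ gt)

-- Searches downwards from `t` for a crossing. `P` need not be monotone, as any crossing serves.
firstTrue : {P : Pred ℕ 0ℓ} → Decidable P → ∀ t → ¬ P 0 → P t → ∃ λ j → ¬ P j × P (suc j)
firstTrue P? zero    ¬p₀ p = contradiction p ¬p₀
firstTrue P? (suc t) ¬p₀ p with P? t
... | yes q = firstTrue P? t ¬p₀ q
... | no ¬q = t , ¬q , p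

unsafe-few : ∀ {n} b h x → b ≤ h + x → 16 * h ≤ n → 16 * x ≤ n → 8 * b ≤ n
unsafe-few {n} b h x b≤ h≤ x≤ = *-cancelˡ-≤ 2 (begin
  2 * (8 * b)        ≡⟨ *-assoc 2 8 b ⟨
  16 * b             ≤⟨ *-monoʳ-≤ 16 b≤ ⟩
  16 * (h + x)       ≡⟨ *-distribˡ-+ 16 h x ⟩
  16 * h + 16 * x    ≤⟨ +-mono-≤ h≤ x≤ ⟩
  n + n              ≡⟨ cong (n +_) (+-identityʳ n) ⟨
  2 * n              ∎)
  where open ≤-Reasoning

safe-large : ∀ {n} s b → n ≤ s + b → 8 * b ≤ n → n ≤ 8 * s
safe-large {n} s b n≤ b≤ = +-cancelʳ-≤ n _ _ (begin
  n + n              ≡⟨ cong (n +_) (+-identityʳ n) ⟨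
  2 * n              ≤⟨ *-monoˡ-≤ n {2} {8} (s≤s (s≤s z≤n)) ⟩
  8 * n              ≤⟨ *-monoʳ-≤ 8 n≤ ⟩
  8 * (s + b)        ≡⟨ *-distribˡ-+ 8 s b ⟩
  8 * s + 8 * b      ≤⟨ +-monoʳ-≤ (8 * s) b≤ ⟩
  8 * s + n          ∎)
  where open ≤-Reasoning

-- Unsafe, low-label and high-label vertices each make up at most an eighth, so the middle class
-- keeps about 5/8. Were it at most half, 8n would be below 7n.
middle-majority : ∀ {n} s b lo r hi → n ≤ s + b → s ≤ lo + (r + hi) → 8 * b ≤ n → 8 * lo < n → 8 * hi < n → n < r + r
middle-majority {n} s b lo r hi n≤ s≤ b≤ lo< hi< = ≰⇒> λ 2r≤n → <-irrefl refl (begin-strict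
  8 * n                                              ≤⟨ *-monoʳ-≤ 8 (≤-trans n≤ (+-monoˡ-≤ b s≤)) ⟩
  8 * (lo + (r + hi) + b)                            ≡⟨ expand lo r hi b ⟩
  8 * lo + 8 * hi + (8 * b + 4 * (r + r))            <⟨ +-mono-<-≤ (+-mono-< lo< hi<) (+-mono-≤ b≤ (*-monoʳ-≤ 4 2r≤n)) ⟩
  n + n + (n + 4 * n)                                ≤⟨ m≤m+n _ n ⟩
  n + n + (n + 4 * n) + n                            ≡⟨ collect n ⟩
  8 * n                                              ∎)
  where
  open ≤-Reasoning
  open +-*-Solver
  expand : ∀ lo r hi b → 8 * (lo + (r + hi) + b) ≡ 8 * lo + 8 * hi + (8 * b + 4 * (r + r))
  expand = solve 4 (λ lo r hi b → con 8 :* (lo :+ (r :+ hi) :+ b) :=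
    con 8 :* lo :+ con 8 :* hi :+ (con 8 :* b :+ con 4 :* (r :+ r))) refl
  collect : ∀ n → n + n + (n + 4 * n) + n ≡ 8 * n
  collect = solve 1 (λ n → n :+ n :+ (n :+ con 4 :* n) :+ n := con 8 :* n) refl

module _ (E : EdgeList m (suc n)) (mixing : Mixing E) (K : ℕ) where
  open SparseGraph E K

  -- Orders the classes by label and cuts at `j`. The labels up to `j` hold an eighth of the
  -- vertices, so by mixing those above `j` cannot; those below `j` do not either, so the single
  -- class `j` has the majority.
  refuge : 16 * # high? ≤ suc n → 16 * (k * (3 + K)) ≤ suc n → (c : Cops (suc n) k) → Refuge G c
  refuge {k} fewHigh fewCops c = record
    { Region   = λ v → Safe v × toℕ (label v) ≡ j
    ; region?  = middle?
    ; majority = middle-majority (# safe?) (# unsafe?) (# (below? j)) (# middle?) (# (above? j)) total split few (≰⇒> lower) (≰⇒> upper)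
    ; away     = λ ((_ , a) , _) → a
    ; linked   = λ (_ , eu) (_ , ev) → reflects (Fin.toℕ-injective (trans eu (≡.sym ev)))
    }
    where
    -- `Low` is included because `G` drops edges at high vertices; a non-loop mixing edge between
    -- safe vertices is then an edge of `G`.
    Safe : Pred (Fin (suc n)) 0ℓ
    Safe v = Low v × Away G c v
    safe? : Decidable Safe
    safe? v = low? v ×-dec Fin.all? (λ i → ¬? (near? (c i) v))
    unsafe? : Decidable (λ v → ¬ Safe v)
    unsafe? v = ¬? (safe? v)
    threatened? : Decidable (λ v → ∃ λ i → Near G (c i) v)
    threatened? v = Fin.any? (λ i → near? (c i) v)
    reason : ∀ {v} → ¬ Safe v → ¬ Low v ⊎ ∃ λ i → Near G (c i) v
    reason {v} ¬safe = [ inj₂ , (λ ¬t → inj₁ (λ low → ¬safe (low , λ i near → ¬t (i , near)))) ]′ (toSum (threatened? v))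
    few : 8 * # unsafe? ≤ suc n
    few = unsafe-few (# unsafe?) (# high?) (k * (3 + K)) (≤-trans (#-∪ unsafe? high? threatened? reason)
      (+-monoʳ-≤ (# high?) (≤-trans (#-⋃ threatened? (λ i → near? (c i)) id) (sum≤n*c (#-near ∘ c))))) fewHigh fewCops
    total : suc n ≤ # safe? + # unsafe?
    total = #-complement safe? unsafe? (toSum ∘ safe?)

    equiv : IsEquivalence (Star (AwayStep G c))
    equiv = record { refl = ε ; sym = reverse (λ (adj , a , a′) → Graph.sym G adj , a′ , a) ; trans = _◅◅_ }
    joined : ∀ {i} → Safe (proj₁ (E i)) × Safe (proj₂ (E i)) → Star (AwayStep G c) (proj₁ (E i)) (proj₂ (E i))
    joined {i} ((lu , au) , (lv , av)) =
      -- A loop of `E` becomes the empty walk.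
      [ (λ same → subst (Star (AwayStep G c) (proj₁ (E i))) same ε)
      , (λ u≢v → (inj₂ (lu , lv , u≢v , i , inj₁ refl) , au , av) ◅ ε) ]′ (toSum (proj₁ (E i) Fin.≟ proj₂ (E i)))
    labelling = components equiv E (λ i → safe? (proj₁ (E i)) ×-dec safe? (proj₂ (E i))) joined
    label = proj₁ labelling
    respects = proj₁ (proj₂ labelling)
    reflects = proj₂ (proj₂ labelling)

    below? : ∀ t → Decidable (λ v → Safe v × toℕ (label v) < t)
    below? t v = safe? v ×-dec (toℕ (label v) <? t)
    above? : ∀ t → Decidable (λ v → Safe v × t < toℕ (label v))
    above? t v = safe? v ×-dec (t <? toℕ (label v))

    -- j is the label at which the classes, added up in order, reach an eighth of the vertices.
    crossing : ∃ λ j → ¬ Large (below? j) × Large (below? (suc j))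
    crossing = firstTrue (λ t → suc n ≤? 8 * # (below? t)) (suc n)
      (λ large → contradiction (≤-trans large (≤-reflexive (cong (8 *_) (#-empty (below? 0) (λ ()))))) λ ())
      (≤-trans (safe-large (# safe?) (# unsafe?) total few)
        (*-monoʳ-≤ 8 (#-mono safe? (below? (suc n)) (λ {v} s → s , Fin.toℕ<n (label v)))))
    j = proj₁ crossing
    lower = proj₁ (proj₂ crossing)
    upper : ¬ Large (above? j)
    upper large = let i , (su , lu) , (sv , lv) = mixing (below? (suc j)) (above? j) (proj₂ (proj₂ crossing)) large
      -- The mixing edge has safe ends, hence equal labels, yet one label is at most `j` and the
      -- other exceeds it.
      in <⇒≱ lv (subst (λ x → toℕ x ≤ j) (respects (su , sv)) (≤-pred lu))
    middle? : Decidable (λ v → Safe v × toℕ (label v) ≡ j)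
    middle? v = safe? v ×-dec (toℕ (label v) ≟ j)
    split : # safe? ≤ # (below? j) + (# middle? + # (above? j))
    split = ≤-trans (#-∪ safe? (below? j) rest? cases) (+-monoʳ-≤ (# (below? j)) (#-∪ rest? middle? (above? j) id))
      where
      rest? : Decidable (λ v → (Safe v × toℕ (label v) ≡ j) ⊎ (Safe v × j < toℕ (label v)))
      rest? v = middle? v ⊎-dec above? j v
      cases : ∀ {v} → Safe v → (Safe v × toℕ (label v) < j) ⊎ (Safe v × toℕ (label v) ≡ j) ⊎ (Safe v × j < toℕ (label v))
      cases {v} s = Sum.map (s ,_) (Sum.map (s ,_) (s ,_)) (compare (toℕ (label v)) j)

  copWin-bound : 16 * # high? ≤ suc n → CopWin G k → suc n ≤ 16 * (3 + K) * k
  copWin-bound {k} fewHigh win = ≮⇒≥ λ fewCops → evasion (refuge fewHigh (≤-trans (≤-reflexive regroup) (<⇒≤ fewCops))) win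
    where
    regroup : 16 * (k * (3 + K)) ≡ 16 * (3 + K) * k
    regroup = trans (cong (16 *_) (*-comm k (3 + K))) (≡.sym (*-assoc 16 (3 + K) k))

high-few : ∀ c .{{_ : NonZero c}} h N → c * 32 * h ≤ c * N * 2 → 16 * h ≤ N
high-few c h N le = *-cancelˡ-≤ 2 (*-cancelˡ-≤ c (begin
  c * (2 * (16 * h))   ≡⟨ cong (c *_) (*-assoc 2 16 h) ⟨
  c * (32 * h)         ≡⟨ *-assoc c 32 h ⟨
  c * 32 * h           ≤⟨ le ⟩
  c * N * 2            ≡⟨ *-assoc c N 2 ⟩
  c * (N * 2)          ≡⟨ cong (c *_) (*-comm N 2) ⟩
  c * (2 * N)          ∎))
  where open ≤-Reasoning

-- The degree bound is 100 * 32 because, with 100 (n + 1) edges, at most 1/16 of the vertices exceed it.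
linearCopNumber : ∀ n → Σ (Graph (suc n)) λ G → Connected G × (∀ k → CopWin G k → suc n ≤ 16 * (3 + 100 * 32) * k)
linearCopNumber n =
  let E , mixing = sparseMixing n
      open SparseGraph E (100 * 32)
  in G , connected E (100 * 32) , λ k → copWin-bound E mixing (100 * 32) (high-few 100 (# high?) (suc n) #-high)

-- The constant `c` is the fraction `p / q`, here 1/51248. Bounding every winning `k` bounds the
-- least one, the cop number.
theorem7p1 : Σ ℕ λ p → Σ ℕ λ q → 0 < p × 0 < q ×
    ((n : ℕ) → 1 ≤ n → Σ (Graph n) λ G → Connected G ×
    ((k : ℕ) → CopWin G k → p * n ≤ q * k))
theorem7p1 = 1 , 16 * (3 + 100 * 32) , s≤s z≤n , s≤s z≤n , λ where
  (suc n) _ → let G , conn , bound = linearCopNumber n in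
    G , conn , λ k win → ≤-trans (≤-reflexive (*-identityˡ (suc n))) (bound k win)
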